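{- Let $(L,\leq)$ be a bounded distributive lattice with least element $\bot$ and greatest element $\top$, and let $\mathbb{L_A}=(L,\sup,\inf,\bot,\top)$ be the corresponding semiring. For every satisfiable $\mathbb{L_A}$-annotated $\mathcal{ELHI}^n_\bot$ ontology $\mathcal O^{\mathbb{L_A}}=\langle\mathcal O,\lambda\rangle$, $$\mathcal P(\alpha,\mathcal O^{\mathbb{L_A}})=\sup\Big\{\inf_{\beta\in\mathcal M}\lambda(\beta)\ \Big|\ \mathcal M\subseteq\mathcal O,\ \mathcal M\models\alpha\Big\}$$ holds if: (1) $\alpha$ is a BCQ, an assertion, or an RI whose left-hand side is satisfiable w.r.t. $\mathcal O$; or (2) $\alpha$ is a GCI between basic concepts whose left-hand side is satisfiable w.r.t. $\mathcal O$ and $\mathcal O$ does not contain any GCI with the concept $\top$ as left-hand side.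
   Context: Syntax. Let $\mathsf{N_C},\mathsf{N_R},\mathsf{N_I}$ be mutually disjoint countable sets of concept, role and individual names. A role $P$ is a role name $R\in\mathsf{N_R}$ or an inverse role $R^-$. Concepts: $C::=A\mid\exists P.C\mid C\sqcap C\mid\top$ ($A\in\mathsf{N_C}$); $\exists P$ abbreviates $\exists P.\top$; basic concepts are those of the form $A$ or $\exists P$. $\mathcal{ELHI}^n_\bot$ axioms: assertions $A(a)$, $R(a,b)$; GCIs $C\sqsubseteq D$ with $C::=A\mid\exists P.C\mid C\sqcap C\mid\top$ and $D::=A\mid\exists P.\top\mid\bot$; role inclusions (RIs) $P\sqsubseteq Q$ (positive) and $P\sqcap Q\sqsubseteq\bot$ (negative). An ontology is a finite set of axioms. A BCQ is $\exists\vec y\,\phi(\vec y)$ with $\phi$ a conjunction of atoms $A(t)$, $R(t,t')$, terms in $\mathsf{N_I}\cup\vec y$. Classical interpretations, models, satisfaction and entailment $\models$ are the usual (first-order) ones for description logics. A concept or role $E$ is satisfiable w.r.t. $\mathcal O$ if $E^{\mathcal I}\neq\emptyset$ for some model $\mathcal I$ of $\mathcal O$. Annotated semantics (for a commutative semiring $\mathbb K=(K,\oplus,\otimes,\mathbf 0,\mathbf 1)$; here $\mathbb K=\mathbb{L_A}$, so $\oplus=\sup$, $\otimes=\inf$, $\mathbf 0$ and $\mathbf 1$ the least and greatest lattice elements). A $\mathbb K$-annotated ontology is a pair $\langle\mathcal O,\lambda\rangle$ with $\lambda:\mathcal O\to K\setminus\{\mathbf 0\}$, identified with the set of annotated axioms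 $(\alpha,\lambda(\alpha))$. A $\mathbb K$-annotated interpretation $\mathcal I$ has a nonempty domain $\Delta^{\mathcal I}$ and maps $a\in\mathsf{N_I}$ to $a^{\mathcal I}\in\Delta^{\mathcal I}$, $A\in\mathsf{N_C}$ to $A^{\mathcal I}\subseteq\Delta^{\mathcal I}\times K$, $R\in\mathsf{N_R}$ to $R^{\mathcal I}\subseteq\Delta^{\mathcal I}\times\Delta^{\mathcal I}\times K$, with (for the concepts $\top,\bot$) $\top^{\mathcal I}=\Delta^{\mathcal I}\times\{\mathbf 1\}$, $\bot^{\mathcal I}=\emptyset$, $(R^-)^{\mathcal I}=\{(e,d,\kappa)\mid(d,e,\kappa)\in R^{\mathcal I}\}$, $(\exists P.C)^{\mathcal I}=\{(d,\kappa\otimes\kappa')\mid\exists e:(d,e,\kappa)\in P^{\mathcal I},(e,\kappa')\in C^{\mathcal I}\}$, $(C\sqcap D)^{\mathcal I}=\{(d,\kappa\otimes\kappa')\mid(d,\kappa)\in C^{\mathcal I},(d,\kappa')\in D^{\mathcal I}\}$, $(P\sqcap Q)^{\mathcal I}=\{(d,e,\kappa\otimes\kappa')\mid(d,e,\kappa)\in P^{\mathcal I},(d,e,\kappa')\in Q^{\mathcal I}\}$. $\mathcal I$ satisfies $(C\sqsubseteq D,\kappa)$ if $(d,\kappa')\in C^{\mathcal I}$ implies $(d,\kappa\otimes\kappa')\in D^{\mathcal I}$; $(P\sqsubseteq Q,\kappa)$ if $(d,e,\kappa')\in P^{\mathcal I}$ implies $(d,e,\kappa\otimes\kappa')\in Q^{\mathcal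 I}$; $(P\sqcap Q\sqsubseteq\bot,\kappa)$ if $(P\sqcap Q)^{\mathcal I}=\emptyset$; $(A(a),\kappa)$ if $(a^{\mathcal I},\kappa)\in A^{\mathcal I}$; $(R(a,b),\kappa)$ if $(a^{\mathcal I},b^{\mathcal I},\kappa)\in R^{\mathcal I}$. $\mathcal I\models(q,\kappa)$ for a BCQ $q$ if there are a map $\pi$ from the terms of $q$ to $\Delta^{\mathcal I}$ with $\pi(c)=c^{\mathcal I}$ for $c\in\mathsf{N_I}$ and, for each atom occurrence $E(\vec t)$ of $q$, some $\kappa_{E(\vec t)}\in K$ with $(\pi(\vec t),\kappa_{E(\vec t)})\in E^{\mathcal I}$, such that $\kappa$ is the $\otimes$-product of all these elements. Models satisfy all annotated axioms; $\mathcal O^{\mathbb K}$ is satisfiable if it has a model; $\mathcal O^{\mathbb K}\models(\alpha,\kappa)$ if every model satisfies $(\alpha,\kappa)$. Provenance. $\mathcal P(\alpha,\mathcal O^{\mathbb K})=\bigoplus_{\kappa:\ \mathcal O^{\mathbb K}\models(\alpha,\kappa)}\kappa$; here it is the supremum in $L$ of the set $\{\ell\in L\mid\mathcal O^{\mathbb{L_A}}\models(\alpha,\ell)\}$. The supremum of the empty set is the least element of $L$ and the infimum of the empty set is its greatest element.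
   Formalization: In (2), GCIs whose left-hand side is a conjunction of copies of ⊤ (such as ⊤⊓⊤) are excluded as well as those with ⊤ itself, since the claim fails otherwise: for O = {⊤⊓⊤ ⊑ B} annotated with the greatest element and α = A ⊑ B, the two sides differ. -}

module Defs where

open import Level using (Level; 0ℓ; Lift) renaming (suc to lsuc; _⊔_ to _⊔ˡ_)
open import Data.Nat using (ℕ)
open import Data.Fin using (Fin; zero; suc)
open import Data.Fin.Subset using (Subset; inside; outside) renaming (_∈_ to _∈ˢ_)
open import Data.Vec using ([]; _∷_)
open import Data.List using (List; foldr)
open import Data.List.Relation.Unary.All using (All)
open import Data.List.Relation.Binary.Pointwise using (Pointwise)
open import Data.Product using (∃-syntax; Σ-syntax; _×_)
open import Data.Sum using (_⊎_; [_,_]′)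
open import Data.Empty.Polymorphic using () renaming (⊥ to Empty)
open import Data.Unit.Polymorphic using () renaming (⊤ to Unit)
open import Function using (_∘_)
open import Function.Bundles using (_↣_)
open import Function.Definitions using (Injective)
open import Relation.Nullary using (¬_)
open import Relation.Unary using (Pred)
open import Relation.Binary.Definitions using (_Respects_)
open import Relation.Binary.PropositionalEquality using (_≡_)
open import Relation.Binary.Lattice.Bundles using (BoundedLattice)

------------------------------------------------------------------------
-- Syntax

-- The three kinds of names live in separate types, hence are disjoint.
record Signature : Set₁ where
  field
    NC NR NI     : Set
    NC-countable : NC ↣ ℕ
    NR-countable : NR ↣ ℕ
    NI-countable : NI ↣ ℕ

module _ (S : Signature) where
  open Signature S

  data Role : Set where
    role : NR → Role
    inv  : NR → Role

  data Concept : Set where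
    name : NC → Concept
    some : Role → Concept → Concept
    _⊓_  : Concept → Concept → Concept
    top  : Concept

  data Basic : Set where
    nameᵇ : NC → Basic
    someᵇ : Role → Basic

  data Rhs : Set where
    basic : Basic → Rhs
    bot   : Rhs

  data Axiom : Set where
    conceptAssertion : NC → NI → Axiom
    roleAssertion    : NR → NI → NI → Axiom
    gci              : Concept → Rhs → Axiom
    positiveRI       : Role → Role → Axiom
    -- negativeRI P Q is P ⊓ Q ⊑ ⊥
    negativeRI       : Role → Role → Axiom

  Term : ℕ → Set
  Term n = NI ⊎ Fin n

  data Atom (n : ℕ) : Set where
    conceptAtom : NC → Term n → Atom n
    roleAtom    : NR → Term n → Term n → Atom n

  -- A list of atoms, so that repeated atoms count as distinct occurrences.
  record BCQ : Set where
    field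
      #vars : ℕ
      atoms : List (Atom #vars)

  data Formula : Set where
    axiomᶠ : Axiom → Formula
    queryᶠ : BCQ → Formula

  -- A finite set of axioms, given by an enumeration without repetitions, so
  -- that subsets of the ontology are exactly the subsets of Fin size.
  record Ontology : Set where
    field
      size     : ℕ
      axiom    : Fin size → Axiom
      distinct : Injective _≡_ _≡_ axiom

module _ {S : Signature} where

  ⌜_⌝ : Basic S → Concept S
  ⌜ nameᵇ A ⌝ = name A
  ⌜ someᵇ P ⌝ = some P top

  -- The concept ⊤ up to trivial conjunctions: a GCI ⊤ ⊓ ⊤ ⊑ B must be excluded
  -- like ⊤ ⊑ B, as the equation fails in its presence just the same.
  data IsTop : Concept S → Set where
    top : IsTop top
    _⊓_ : ∀ {C D} → IsTop C → IsTop D → IsTop (C ⊓ D)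

  NoTopLhs : Ontology S → Set
  NoTopLhs O = ∀ i {C D} → Ontology.axiom O i ≡ gci C D → ¬ IsTop C

  ⟨_⟩ : Ontology S → Pred (Axiom S) 0ℓ
  ⟨ O ⟩ β = ∃[ i ] Ontology.axiom O i ≡ β

  _↾_ : (O : Ontology S) → Subset (Ontology.size O) → Pred (Axiom S) 0ℓ
  (O ↾ M) β = ∃[ i ] (i ∈ˢ M × Ontology.axiom O i ≡ β)

------------------------------------------------------------------------
-- Classical semantics

record Interpretation (S : Signature) (i : Level) : Set (lsuc i) where
  open Signature S
  field
    Δ        : Set i
    nonempty : Δ
    indᴵ     : NI → Δ
    concᴵ    : NC → Δ → Set i
    roleᴵ    : NR → Δ → Δ → Set i

module Classical {S : Signature} {i : Level} (I : Interpretation S i) where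
  open Interpretation I

  R⟦_⟧ : Role S → Δ → Δ → Set i
  R⟦ role R ⟧ d e = roleᴵ R d e
  R⟦ inv R ⟧  d e = roleᴵ R e d

  C⟦_⟧ : Concept S → Δ → Set i
  C⟦ name A ⟧   d = concᴵ A d
  C⟦ some P C ⟧ d = ∃[ e ] (R⟦ P ⟧ d e × C⟦ C ⟧ e)
  C⟦ C ⊓ D ⟧    d = C⟦ C ⟧ d × C⟦ D ⟧ d
  C⟦ top ⟧      d = Unit

  D⟦_⟧ : Rhs S → Δ → Set i
  D⟦ basic B ⟧ d = C⟦ ⌜ B ⌝ ⟧ d
  D⟦ bot ⟧     d = Empty

  SatAxiom : Axiom S → Set i
  SatAxiom (conceptAssertion A a) = concᴵ A (indᴵ a)
  SatAxiom (roleAssertion R a b)  = roleᴵ R (indᴵ a) (indᴵ b)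
  SatAxiom (gci C D)              = ∀ d → C⟦ C ⟧ d → D⟦ D ⟧ d
  SatAxiom (positiveRI P Q)       = ∀ d e → R⟦ P ⟧ d e → R⟦ Q ⟧ d e
  SatAxiom (negativeRI P Q)       = ∀ d e → ¬ (R⟦ P ⟧ d e × R⟦ Q ⟧ d e)

  SatAtom : ∀ {n} → (Fin n → Δ) → Atom S n → Set i
  SatAtom π (conceptAtom A t) = concᴵ A ([ indᴵ , π ]′ t)
  SatAtom π (roleAtom R t u)  = roleᴵ R ([ indᴵ , π ]′ t) ([ indᴵ , π ]′ u)

  Sat : Formula S → Set i
  Sat (axiomᶠ β) = SatAxiom β
  Sat (queryᶠ q) = Σ[ π ∈ (Fin #vars → Δ) ] All (SatAtom π) atoms
    where open BCQ q

  Model : Pred (Axiom S) 0ℓ → Set i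
  Model Γ = ∀ β → Γ β → SatAxiom β

module _ {S : Signature} (i : Level) where
  open Interpretation using (Δ)
  open Classical

  Entails : Pred (Axiom S) 0ℓ → Formula S → Set (lsuc i)
  Entails Γ φ = (I : Interpretation S i) → Model I Γ → Sat I φ

  ConceptSatisfiable : Ontology S → Concept S → Set (lsuc i)
  ConceptSatisfiable O C =
    Σ[ I ∈ Interpretation S i ] (Model I ⟨ O ⟩ × ∃[ d ] C⟦_⟧ I C d)

  RoleSatisfiable : Ontology S → Role S → Set (lsuc i)
  RoleSatisfiable O P =
    Σ[ I ∈ Interpretation S i ] (Model I ⟨ O ⟩ × ∃[ d ] ∃[ e ] R⟦_⟧ I P d e)

  RoleConjunctionSatisfiable : Ontology S → Role S → Role S → Set (lsuc i)
  RoleConjunctionSatisfiable O P Q =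
    Σ[ I ∈ Interpretation S i ] (Model I ⟨ O ⟩ ×
      ∃[ d ] ∃[ e ] (R⟦_⟧ I P d e × R⟦_⟧ I Q d e))

  data Case₁ (O : Ontology S) : Formula S → Set (lsuc i) where
    query            : ∀ q → Case₁ O (queryᶠ q)
    conceptAssertion : ∀ A a → Case₁ O (axiomᶠ (conceptAssertion A a))
    roleAssertion    : ∀ R a b → Case₁ O (axiomᶠ (roleAssertion R a b))
    positiveRI       : ∀ P Q → RoleSatisfiable O P →
                       Case₁ O (axiomᶠ (positiveRI P Q))
    negativeRI       : ∀ P Q → RoleConjunctionSatisfiable O P Q →
                       Case₁ O (axiomᶠ (negativeRI P Q))

  data Case₂ (O : Ontology S) : Formula S → Set (lsuc i) where
    basicGCI : ∀ B B′ → ConceptSatisfiable O ⌜ B ⌝ → NoTopLhs O →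
               Case₂ O (axiomᶠ (gci ⌜ B ⌝ (basic B′)))

------------------------------------------------------------------------
-- Lattices and annotated semantics

module _ {c ℓ₁ ℓ₂ : Level} (L : BoundedLattice c ℓ₁ ℓ₂) where
  open BoundedLattice L

  IsSupremum : ∀ {p} → Pred Carrier p → Carrier → Set (c ⊔ˡ ℓ₂ ⊔ˡ p)
  IsSupremum X s = (∀ x → X x → x ≤ s) × (∀ u → (∀ x → X x → x ≤ u) → s ≤ u)

  ⋀ : ∀ {n} → Subset n → (Fin n → Carrier) → Carrier
  ⋀ []            f = ⊤
  ⋀ (inside ∷ M)  f = f zero ∧ ⋀ M (f ∘ suc)
  ⋀ (outside ∷ M) f = ⋀ M (f ∘ suc)

  record AnnotatedOntology (S : Signature) : Set (c ⊔ˡ ℓ₁) where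
    field
      ontology : Ontology S
    open Ontology ontology public
    field
      ann   : Fin size → Carrier
      ann≉⊥ : ∀ j → ¬ (ann j ≈ ⊥)

  private
    i : Level
    i = c ⊔ˡ ℓ₁ ⊔ˡ ℓ₂

  record AnnInterpretation (S : Signature) : Set (lsuc i) where
    open Signature S
    field
      Δ        : Set i
      nonempty : Δ
      indᴵ     : NI → Δ
      concᴵ    : NC → Δ → Carrier → Set i
      roleᴵ    : NR → Δ → Δ → Carrier → Set i
      -- Elements of K are lattice elements up to _≈_.
      concᴵ-resp : ∀ A d → concᴵ A d Respects _≈_
      roleᴵ-resp : ∀ R d e → roleᴵ R d e Respects _≈_

  module Annotated {S : Signature} (I : AnnInterpretation S) where
    open AnnInterpretation I

    R⟦_⟧ : Role S → Δ → Δ → Carrier → Set i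
    R⟦ role R ⟧ d e κ = roleᴵ R d e κ
    R⟦ inv R ⟧  d e κ = roleᴵ R e d κ

    C⟦_⟧ : Concept S → Δ → Carrier → Set i
    C⟦ name A ⟧   d κ = concᴵ A d κ
    C⟦ some P C ⟧ d κ = ∃[ e ] ∃[ κ₁ ] ∃[ κ₂ ]
      (R⟦ P ⟧ d e κ₁ × C⟦ C ⟧ e κ₂ × κ ≈ κ₁ ∧ κ₂)
    C⟦ C ⊓ D ⟧    d κ = ∃[ κ₁ ] ∃[ κ₂ ]
      (C⟦ C ⟧ d κ₁ × C⟦ D ⟧ d κ₂ × κ ≈ κ₁ ∧ κ₂)
    C⟦ top ⟧      d κ = Lift i (κ ≈ ⊤)

    RoleConjunction : Role S → Role S → Δ → Δ → Carrier → Set i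
    RoleConjunction P Q d e κ = ∃[ κ₁ ] ∃[ κ₂ ]
      (R⟦ P ⟧ d e κ₁ × R⟦ Q ⟧ d e κ₂ × κ ≈ κ₁ ∧ κ₂)

    D⟦_⟧ : Rhs S → Δ → Carrier → Set i
    D⟦ basic B ⟧ d κ = C⟦ ⌜ B ⌝ ⟧ d κ
    D⟦ bot ⟧     d κ = Empty

    SatAxiom : Axiom S → Carrier → Set i
    SatAxiom (conceptAssertion A a) κ = concᴵ A (indᴵ a) κ
    SatAxiom (roleAssertion R a b)  κ = roleᴵ R (indᴵ a) (indᴵ b) κ
    SatAxiom (gci C D)              κ =
      ∀ d κ′ → C⟦ C ⟧ d κ′ → D⟦ D ⟧ d (κ ∧ κ′)
    SatAxiom (positiveRI P Q)       κ =
      ∀ d e κ′ → R⟦ P ⟧ d e κ′ → R⟦ Q ⟧ d e (κ ∧ κ′)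
    SatAxiom (negativeRI P Q)       κ =
      ∀ d e κ′ → ¬ RoleConjunction P Q d e κ′

    SatAtom : ∀ {n} → (Fin n → Δ) → Atom S n → Carrier → Set i
    SatAtom π (conceptAtom A t) κ = concᴵ A ([ indᴵ , π ]′ t) κ
    SatAtom π (roleAtom R t u)  κ =
      roleᴵ R ([ indᴵ , π ]′ t) ([ indᴵ , π ]′ u) κ

    Sat : Formula S → Carrier → Set i
    Sat (axiomᶠ β) κ = SatAxiom β κ
    Sat (queryᶠ q) κ = Σ[ π ∈ (Fin #vars → Δ) ] ∃[ κs ]
      (Pointwise (SatAtom π) atoms κs × κ ≈ foldr _∧_ ⊤ κs)
      where open BCQ q

    Model : AnnotatedOntology S → Set i
    Model O = ∀ j → SatAxiom (axiom j) (ann j)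
      where open AnnotatedOntology O

  module _ {S : Signature} where
    open Annotated

    AnnSatisfiable : AnnotatedOntology S → Set (lsuc i)
    AnnSatisfiable O = Σ[ I ∈ AnnInterpretation S ] Model I O

    AnnEntails : AnnotatedOntology S → Formula S → Carrier → Set (lsuc i)
    AnnEntails O φ κ = (I : AnnInterpretation S) → Model I O → Sat I φ κ

    -- 𝒫(φ, O) = p: the semiring sum in (L, sup, inf, ⊥, ⊤) is the supremum
    -- of all entailed annotations.
    IsProvenance : AnnotatedOntology S → Formula S → Carrier →
                   Set (lsuc i)
    IsProvenance O φ p = IsSupremum (AnnEntails O φ) p

    SubsetInfimum : AnnotatedOntology S → Formula S → Pred Carrier (lsuc i)
    SubsetInfimum O φ κ =
      Σ[ M ∈ Subset size ] (Entails i (ontology ↾ M) φ × κ ≈ ⋀ M ann)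
      where open AnnotatedOntology O

{-# OPTIONS --safe #-}

-- Derivations label every fact with the set of axioms they use; facts about
-- seed elements, which realise the left-hand side of an inclusion, may use the
-- additional axiom 0.  The elements of the canonical model are the individuals,
-- the seed elements and one witness per derivation that fires an existential
-- axiom.  Reading a label M as ⋀ M gives an annotated model, and keeping the
-- labels below M₀ gives a classical model of M₀.  Both are initial, so an
-- entailed annotation is some ⋀ M with M ⊨ α, and conversely M₀ ⊨ α yields a
-- derivation with label M ⊆ M₀, whose annotation ⋀ M ≥ ⋀ M₀ is entailed.

module Submission where

open import Level using (Level; suc; _⊔_; lift)
open import Data.Bool using (Bool; true; false)
open import Data.Nat using (ℕ) renaming (suc to 1+)
open import Data.Fin using (Fin; zero) renaming (suc to fsuc)
open import Data.Fin.Subset using (Subset; inside; outside; ⁅_⁆; _∪_; _⊆_; _∈_)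
  renaming (⊥ to ∅)
open import Data.Fin.Subset.Properties
  using (∉⊥; x∈⁅x⁆; x∈⁅y⁆⇒x≡y; p⊆p∪q; q⊆p∪q; x∈p∪q⁻; drop-there; drop-∷-⊆; _⊆?_; ∪-identityʳ)
open import Data.Vec using ([]; _∷_; here; there)
open import Data.List using ([]; _∷_; foldr; map)
open import Data.List.Relation.Unary.All as All using (All; []; _∷_)
open import Data.List.Relation.Binary.Pointwise using (Pointwise; []; _∷_)
open import Data.Product using (_×_; ∃-syntax; Σ-syntax; _,_; proj₁; proj₂)
open import Data.Sum using (_⊎_; inj₁; inj₂; [_,_]′)
open import Data.Unit using (⊤; tt)
open import Data.Empty using (⊥; ⊥-elim)
import Data.Unit.Polymorphic as Unit
open import Function using (_∘_)
open import Function.Bundles using (_⇔_; mk⇔)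
open import Axiom.ExcludedMiddle using (ExcludedMiddle)
open import Relation.Nullary using (¬_; yes; no)
open import Relation.Unary using (Pred)
open import Relation.Binary.Definitions using (_Respects_)
open import Relation.Binary.PropositionalEquality as ≡ using (_≡_)
open import Relation.Binary.Lattice.Bundles using (BoundedLattice)
open import Relation.Binary.Lattice.Structures using (IsDistributiveLattice)
open import Relation.Binary.Lattice.Properties.MeetSemilattice
  using (∧-cong; ∧-comm)
open import Relation.Binary.Lattice.Properties.BoundedMeetSemilattice
  using () renaming (identityˡ to ∧-identityˡ; identityʳ to ∧-identityʳ)
open import Defs

-- Finite sets of axioms, their meets, and suprema in a bounded lattice

∪-least : ∀ {n} {M N K : Subset n} → M ⊆ K → N ⊆ K → M ∪ N ⊆ K
∪-least {M = M} {N} M⊆K N⊆K = [ M⊆K , N⊆K ]′ ∘ x∈p∪q⁻ M N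

⁅⁆-least : ∀ {n} {j : Fin n} {K} → j ∈ K → ⁅ j ⁆ ⊆ K
⁅⁆-least {j = j} j∈K k∈ with ≡.refl ← x∈⁅y⁆⇒x≡y j k∈ = j∈K

∷⊆inside∷ : ∀ {n b} {M : Subset n} → b ∷ M ⊆ inside ∷ M
∷⊆inside∷ here      = here
∷⊆inside∷ (there p) = there p

module LatticeProperties {c ℓ₁ ℓ₂ : Level} (L : BoundedLattice c ℓ₁ ℓ₂) where
  open BoundedLattice L renaming (⊤ to 𝟙; ⊥ to 𝟘)

  ⋀-lower : ∀ {n} (M : Subset n) f {j} → j ∈ M → ⋀ L M f ≤ f j
  ⋀-lower (inside ∷ M)  f here      = x∧y≤x _ _
  ⋀-lower (inside ∷ M)  f (there p) = trans (x∧y≤y _ _) (⋀-lower M (f ∘ fsuc) p)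
  ⋀-lower (outside ∷ M) f (there p) = ⋀-lower M (f ∘ fsuc) p

  ⋀-greatest : ∀ {n} (M : Subset n) f {x} → (∀ {j} → j ∈ M → x ≤ f j) →
               x ≤ ⋀ L M f
  ⋀-greatest []            f h = maximum _
  ⋀-greatest (inside ∷ M)  f h =
    ∧-greatest (h here) (⋀-greatest M (f ∘ fsuc) (h ∘ there))
  ⋀-greatest (outside ∷ M) f h = ⋀-greatest M (f ∘ fsuc) (h ∘ there)

  ⋀-antitone : ∀ {n} {M N : Subset n} f → M ⊆ N → ⋀ L N f ≤ ⋀ L M f
  ⋀-antitone {M = M} {N} f M⊆N = ⋀-greatest M f (⋀-lower N f ∘ M⊆N)

  -- Meet is idempotent, so axioms shared by `M` and `N` do no harm. This is why a derivation can be
  -- labelled by a set of axioms instead of a multiset.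
  ⋀-∪ : ∀ {n} (M N : Subset n) f → ⋀ L (M ∪ N) f ≈ ⋀ L M f ∧ ⋀ L N f
  ⋀-∪ M N f = antisym
    (∧-greatest (⋀-antitone {M = M} f (p⊆p∪q N)) (⋀-antitone {M = N} f (q⊆p∪q M N)))
    (⋀-greatest (M ∪ N) f λ j∈ →
      [ trans (x∧y≤x _ _) ∘ ⋀-lower M f , trans (x∧y≤y _ _) ∘ ⋀-lower N f ]′
      (x∈p∪q⁻ M N j∈))

  ⋀-⁅⁆ : ∀ {n} (j : Fin n) f → ⋀ L ⁅ j ⁆ f ≈ f j
  ⋀-⁅⁆ j f = antisym (⋀-lower ⁅ j ⁆ f (x∈⁅x⁆ j))
    (⋀-greatest ⁅ j ⁆ f λ k∈ →
      reflexive (Eq.reflexive (≡.cong f (≡.sym (x∈⁅y⁆⇒x≡y j k∈)))))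

  ⋀-∅ : ∀ {n} (f : Fin n → Carrier) → ⋀ L ∅ f ≈ 𝟙
  ⋀-∅ f = antisym (maximum _) (⋀-greatest ∅ f (⊥-elim ∘ ∉⊥))

  -- Index `zero` is the extra axiom behind the seed facts. Its annotation `κ` is `𝟙` in the
  -- canonical model and, in an arbitrary model, the annotation at which the seed is realised.
  weight : ∀ {n} → Carrier → (Fin n → Carrier) → Fin (1+ n) → Carrier
  weight κ f zero     = κ
  weight κ f (fsuc j) = f j

  ⋀-weight-𝟙 : ∀ {n} b (M : Subset n) f → ⋀ L (b ∷ M) (weight 𝟙 f) ≈ ⋀ L M f
  ⋀-weight-𝟙 true  M f = ∧-identityˡ boundedMeetSemilattice _
  ⋀-weight-𝟙 false M f = Eq.refl

  -- Sets that are cofinal in each other have the same upper bounds.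
  IsSupremum-cofinal : ∀ {p q} {X : Pred Carrier p} {Y : Pred Carrier q} →
    (∀ {x} → X x → ∃[ y ] (Y y × x ≤ y)) → (∀ {y} → Y y → ∃[ x ] (X x × y ≤ x)) →
    ∀ {s} → IsSupremum L X s → IsSupremum L Y s
  IsSupremum-cofinal X≼Y Y≼X (upper , least) =
    (λ y Yy → let _ , Xx , y≤x = Y≼X Yy in trans y≤x (upper _ Xx)) ,
    (λ u bound → least u λ x Xx → let _ , Yy , x≤y = X≼Y Xx in trans x≤y (bound _ Yy))

  -- Splitting on the first index leads down to single subsets, where excluded middle decides `P`. A
  -- subset outside `P` contributes `𝟘`, and the branches are joined.
  finite-supremum : ∀ {p} → ExcludedMiddle p →
    ∀ {n} (P : Pred (Subset n) p) (f : Subset n → Carrier) →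
    ∃[ s ] IsSupremum L (λ κ → Σ[ M ∈ Subset n ] (P M × κ ≈ f M)) s
  finite-supremum em {ℕ.zero} P f with em {P []}
  ... | yes p = f [] , (λ { x ([] , _ , x≈) → reflexive x≈ }) ,
                       (λ u bound → bound _ ([] , p , Eq.refl))
  ... | no ¬p = 𝟘 , (λ { x ([] , p , _) → ⊥-elim (¬p p) }) , (λ u _ → minimum u)
  finite-supremum em {1+ n} P f
    with finite-supremum em (P ∘ (inside ∷_)) (f ∘ (inside ∷_))
       | finite-supremum em (P ∘ (outside ∷_)) (f ∘ (outside ∷_))
  ... | s , upperˢ , leastˢ | t , upperᵗ , leastᵗ =
    s ∨ t ,
    (λ { x (true  ∷ M , p) → trans (upperˢ x (M , p)) (x≤x∨y s t)
       ; x (false ∷ M , p) → trans (upperᵗ x (M , p)) (y≤x∨y s t) }) ,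
    (λ u bound → ∨-least (leastˢ u λ { x (M , p) → bound x (inside ∷ M , p) })
                         (leastᵗ u λ { x (M , p) → bound x (outside ∷ M , p) }))

-- Labelled derivations over a seed

-- The facts of a generic instance of a left-hand side. `point` is where a concept inclusion is
-- tested; it also makes the canonical domains nonempty.
record Seed (S : Signature) : Set₁ where
  open Signature S
  field
    Point : Set
    point : Point
    conc  : NC → Point → Set
    edge  : NR → Point → Point → Set

module Chase (i : Level) {S : Signature} (O : Ontology S) (G : Seed S) where
  open Signature S
  open Ontology O
  open Seed G

  Label : Set
  Label = Subset (1+ size)

  -- Elements and derivations are generated together, because a witness stores the derivation that
  -- creates it. Derivations with different labels must not share a witness: an annotated model may
  -- supply a different successor for each annotation, and a homomorphism into it has to choose one.
  data Elem : Set i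
  data Conc : Concept S → Elem → Label → Set i
  data Edge : Role S → Elem → Elem → Label → Set i

  data Elem where
    ind     : NI → Elem
    seed    : Point → Elem
    witness : ∀ {j C P d M} → axiom j ≡ gci C (basic (someᵇ P)) → Conc C d M → Elem

  data Conc where
    asserted : ∀ {j A a} → axiom j ≡ conceptAssertion A a →
               Conc (name A) (ind a) ⁅ fsuc j ⁆
    seeded   : ∀ {A x} → conc A x → Conc (name A) (seed x) ⁅ zero ⁆
    derived  : ∀ {j C A d M} → axiom j ≡ gci C (basic (nameᵇ A)) → Conc C d M →
               Conc (name A) d (⁅ fsuc j ⁆ ∪ M)
    both     : ∀ {C D d M N} → Conc C d M → Conc D d N → Conc (C ⊓ D) d (M ∪ N)
    along    : ∀ {P C d e M N} → Edge P d e M → Conc C e N → Conc (some P C) d (M ∪ N)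
    trivial  : ∀ {d} → Conc top d ∅

  data Edge where
    asserted  : ∀ {j R a b} → axiom j ≡ roleAssertion R a b →
                Edge (role R) (ind a) (ind b) ⁅ fsuc j ⁆
    seeded    : ∀ {R x y} → edge R x y → Edge (role R) (seed x) (seed y) ⁅ zero ⁆
    witnessed : ∀ {j C P d M} (eq : axiom j ≡ gci C (basic (someᵇ P))) (p : Conc C d M) →
                Edge P d (witness eq p) (⁅ fsuc j ⁆ ∪ M)
    included  : ∀ {j P Q d e M} → axiom j ≡ positiveRI P Q → Edge P d e M →
                Edge Q d e (⁅ fsuc j ⁆ ∪ M)
    converse  : ∀ {R d e M} → Edge (role R) d e M → Edge (inv R) e d M
    converse⁻ : ∀ {R d e M} → Edge (inv R) d e M → Edge (role R) e d M

  along-top : ∀ {P d e M} → Edge P d e M → Conc (some P top) d M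
  along-top p = ≡.subst (Conc _ _) (∪-identityʳ _) (along p trivial)

  fire : ∀ {j C d M} B → axiom j ≡ gci C (basic B) → Conc C d M →
         Conc ⌜ B ⌝ d (⁅ fsuc j ⁆ ∪ M)
  fire (nameᵇ A) eq p = derived eq p
  fire (someᵇ P) eq p = along-top (witnessed eq p)

  fromSeed : Elem → Bool
  fromSeed (ind a)               = false
  fromSeed (seed x)              = true
  fromSeed (witness {d = d} _ _) = fromSeed d

  -- Assertions join individuals, seeded edges join seed points, and a witness inherits the side of
  -- its parent, so no rule crosses between the sides. This lets `edge-uses-seed` pass through
  -- inverse roles.
  fromSeed-edge : ∀ {P d e M} → Edge P d e M → fromSeed d ≡ fromSeed e
  fromSeed-edge (asserted _)    = ≡.refl
  fromSeed-edge (seeded _)      = ≡.refl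
  fromSeed-edge (witnessed _ _) = ≡.refl
  fromSeed-edge (included _ p)  = fromSeed-edge p
  fromSeed-edge (converse p)    = ≡.sym (fromSeed-edge p)
  fromSeed-edge (converse⁻ p)   = ≡.sym (fromSeed-edge p)

  -- An axiom ⊤ ⊑ B holds at a seed element with its own annotation, which is not
  -- multiplied by that of the left-hand side; no other facts escape the seed.
  module _ (noTop : NoTopLhs O) where
    conc-uses-seed : ∀ {C d M} → fromSeed d ≡ true → Conc C d M → zero ∈ M ⊎ IsTop C
    edge-uses-seed : ∀ {P d e M} → fromSeed d ≡ true → Edge P d e M → zero ∈ M

    conc-uses-seed () (asserted _)
    conc-uses-seed s (seeded _) = inj₁ here
    conc-uses-seed s (derived {j = j} eq p) with conc-uses-seed s p
    ... | inj₁ z = inj₁ (q⊆p∪q ⁅ fsuc j ⁆ _ z)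
    ... | inj₂ t = ⊥-elim (noTop _ eq t)
    conc-uses-seed s (both {M = M} {N} p q) with conc-uses-seed s p | conc-uses-seed s q
    ... | inj₁ z | _      = inj₁ (p⊆p∪q N z)
    ... | inj₂ _ | inj₁ z = inj₁ (q⊆p∪q M N z)
    ... | inj₂ t | inj₂ u = inj₂ (t ⊓ u)
    conc-uses-seed s (along {N = N} p _) = inj₁ (p⊆p∪q N (edge-uses-seed s p))
    conc-uses-seed s trivial = inj₂ top

    edge-uses-seed () (asserted _)
    edge-uses-seed s (seeded _) = here
    edge-uses-seed s (witnessed {j = j} eq p) with conc-uses-seed s p
    ... | inj₁ z = q⊆p∪q ⁅ fsuc j ⁆ _ z
    ... | inj₂ t = ⊥-elim (noTop _ eq t)
    edge-uses-seed s (included {j = j} _ p) = q⊆p∪q ⁅ fsuc j ⁆ _ (edge-uses-seed s p)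
    edge-uses-seed s (converse p)  = edge-uses-seed (≡.trans (fromSeed-edge p) s) p
    edge-uses-seed s (converse⁻ p) = edge-uses-seed (≡.trans (fromSeed-edge p) s) p

  -- An existential axiom only joins an element to its new witness, and assertions only join
  -- individuals, so an edge between seed points goes back to a seeded one.
  seed-edge-uses-seed : ∀ {P x y M} → Edge P (seed x) (seed y) M → zero ∈ M
  seed-edge-uses-seed (seeded _)             = here
  seed-edge-uses-seed (included {j = j} _ p) = q⊆p∪q ⁅ fsuc j ⁆ _ (seed-edge-uses-seed p)
  seed-edge-uses-seed (converse p)           = seed-edge-uses-seed p
  seed-edge-uses-seed (converse⁻ p)          = seed-edge-uses-seed p

  module _ {n} (π : Fin n → Elem) where
    AtomDer : Atom S n → Label → Set i
    AtomDer (conceptAtom A t) = Conc (name A) ([ ind , π ]′ t)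
    AtomDer (roleAtom R t u)  = Edge (role R) ([ ind , π ]′ t) ([ ind , π ]′ u)

    AtomWithin : Label → Atom S n → Set i
    AtomWithin K a = ∃[ M ] (AtomDer a M × M ⊆ K)

    widen : ∀ {K K′} → K ⊆ K′ → ∀ {a} → AtomWithin K a → AtomWithin K′ a
    widen K⊆K′ (M , p , M⊆K) = M , p , K⊆K′ ∘ M⊆K

-- Soundness of derivations in classical models

-- A homomorphism from the seed into `J`, to be extended to all elements.
record Realisation {i : Level} {S : Signature} (G : Seed S) (J : Interpretation S i) : Set i where
  open Interpretation J
  field
    at     : Seed.Point G → Δ
    conc-✓ : ∀ {A x} → Seed.conc G A x → concᴵ A (at x)
    edge-✓ : ∀ {R x y} → Seed.edge G R x y → roleᴵ R (at x) (at y)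

module ClassicalSoundness {i : Level} {S : Signature} (O : Ontology S) (G : Seed S)
  (M₀ : Subset (Ontology.size O)) (J : Interpretation S i)
  (model : Classical.Model J (O ↾ M₀)) (realisation : Realisation G J) where

  open Ontology O
  open Chase i O G
  open Interpretation J
  open Classical J
  open Realisation realisation

  private
    K : Label
    K = inside ∷ M₀

    apply : ∀ {j β} M → ⁅ fsuc j ⁆ ∪ M ⊆ K → axiom j ≡ β → SatAxiom β
    apply {j} M s eq = model _ (j , drop-there (s (p⊆p∪q M (x∈⁅x⁆ (fsuc j)))) , eq)

    right : ∀ {j : Fin size} {M} → ⁅ fsuc j ⁆ ∪ M ⊆ K → M ⊆ K
    right {j} {M} s = s ∘ q⊆p∪q ⁅ fsuc j ⁆ M

  -- A witness whose existence needs axioms outside M₀ is sent to an arbitrary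
  -- element: facts about it with a label below M₀ hold everywhere.
  ⟦_⟧ : Elem → Δ
  conc-sound : ∀ {C d M} → Conc C d M → M ⊆ K → C⟦ C ⟧ ⟦ d ⟧
  edge-sound : ∀ {P d e M} → Edge P d e M → M ⊆ K → R⟦ P ⟧ ⟦ d ⟧ ⟦ e ⟧

  ⟦ ind a ⟧  = indᴵ a
  ⟦ seed x ⟧ = at x
  ⟦ witness {j} {M = M} eq p ⟧ with ⁅ fsuc j ⁆ ∪ M ⊆? K
  ... | yes s = proj₁ (apply M s eq _ (conc-sound p (right s)))
  ... | no _  = nonempty

  conc-sound (asserted {j} eq) s = model _ (j , drop-there (s (x∈⁅x⁆ (fsuc j))) , eq)
  conc-sound (seeded c)        s = conc-✓ c
  conc-sound (derived eq p)    s = apply _ s eq _ (conc-sound p (right s))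
  conc-sound (both {M = M} {N} p q) s =
    conc-sound p (s ∘ p⊆p∪q N) , conc-sound q (s ∘ q⊆p∪q M N)
  conc-sound (along {M = M} {N} p q) s =
    _ , edge-sound p (s ∘ p⊆p∪q N) , conc-sound q (s ∘ q⊆p∪q M N)
  conc-sound trivial           s = Unit.tt

  edge-sound (asserted {j} eq) s = model _ (j , drop-there (s (x∈⁅x⁆ (fsuc j))) , eq)
  edge-sound (seeded c)        s = edge-✓ c
  -- Repeating the inclusion test unfolds the image of the witness. A negative outcome contradicts
  -- `s`, because the label of the edge is the very set tested.
  edge-sound (witnessed {j} {M = M} eq p) s with ⁅ fsuc j ⁆ ∪ M ⊆? K
  ... | yes s′ = proj₁ (proj₂ (apply M s′ eq _ (conc-sound p (right s′))))
  ... | no s̸   = ⊥-elim (s̸ s)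
  edge-sound (included eq p)   s = apply _ s eq _ _ (edge-sound p (right s))
  edge-sound (converse p)      s = edge-sound p s
  edge-sound (converse⁻ p)     s = edge-sound p s

  module _ {n} (π : Fin n → Elem) where
    term-≡ : (t : Term S n) → ⟦ [ ind , π ]′ t ⟧ ≡ [ indᴵ , ⟦_⟧ ∘ π ]′ t
    term-≡ (inj₁ a) = ≡.refl
    term-≡ (inj₂ x) = ≡.refl

    atom-sound : ∀ a {M} → AtomDer π a M → M ⊆ K → SatAtom (⟦_⟧ ∘ π) a
    atom-sound (conceptAtom A t) p s = ≡.subst (concᴵ A) (term-≡ t) (conc-sound p s)
    atom-sound (roleAtom R t u)  p s =
      ≡.subst₂ (roleᴵ R) (term-≡ t) (term-≡ u) (edge-sound p s)

-- Annotated interpretations, and classical models turned into them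

module _ {c ℓ₁ ℓ₂ : Level} (L : BoundedLattice c ℓ₁ ℓ₂) {S : Signature} where
  open BoundedLattice L renaming (⊤ to 𝟙; ⊥ to 𝟘)

  record AnnRealisation (G : Seed S) (I : AnnInterpretation L S) (κ : Carrier) :
                        Set (c ⊔ ℓ₁ ⊔ ℓ₂) where
    open AnnInterpretation I
    field
      at     : Seed.Point G → Δ
      conc-✓ : ∀ {A x} → Seed.conc G A x → concᴵ A (at x) κ
      edge-✓ : ∀ {R x y} → Seed.edge G R x y → roleᴵ R (at x) (at y) κ

  module _ (I : AnnInterpretation L S) where
    open AnnInterpretation I
    open Annotated L I

    role-resp : ∀ P d e → R⟦ P ⟧ d e Respects _≈_
    role-resp (role R) d e = roleᴵ-resp R d e
    role-resp (inv R)  d e = roleᴵ-resp R e d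

    conc-resp : ∀ C d → C⟦ C ⟧ d Respects _≈_
    conc-resp (name A)   d eq p = concᴵ-resp A d eq p
    conc-resp (some P C) d eq (e , κ₁ , κ₂ , p , q , κ≈) =
      e , κ₁ , κ₂ , p , q , Eq.trans (Eq.sym eq) κ≈
    conc-resp (C ⊓ D)    d eq (κ₁ , κ₂ , p , q , κ≈) =
      κ₁ , κ₂ , p , q , Eq.trans (Eq.sym eq) κ≈
    conc-resp top        d eq (lift κ≈) = lift (Eq.trans (Eq.sym eq) κ≈)

    -- The filler `top` has only the annotation `𝟙`, so an annotation of the existential is that of
    -- a single edge. This edge supplies the images of witnesses.
    some-top-edge : ∀ P {d κ} → C⟦ some P top ⟧ d κ → ∃[ e ] R⟦ P ⟧ d e κ
    some-top-edge P (e , κ₁ , κ₂ , p , lift κ₂≈ , κ≈) = e , role-resp P _ _ (Eq.sym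
      (Eq.trans κ≈ (Eq.trans (∧-cong meetSemilattice Eq.refl κ₂≈)
                             (∧-identityʳ boundedMeetSemilattice _)))) p

  -- Every fact of `J` receives every annotation, so the annotations of axioms impose nothing beyond
  -- the classical conditions. Classical satisfiability of a left-hand side thereby yields an
  -- annotated model that realises the seed.
  module Constant (J : Interpretation S (c ⊔ ℓ₁ ⊔ ℓ₂)) where
    private module J = Classical J
    open Interpretation J

    constant : AnnInterpretation L S
    constant = record
      { Δ = Δ ; nonempty = nonempty ; indᴵ = indᴵ
      ; concᴵ = λ A d _ → concᴵ A d ; roleᴵ = λ R d e _ → roleᴵ R d e
      ; concᴵ-resp = λ _ _ _ p → p ; roleᴵ-resp = λ _ _ _ _ p → p }

    private module I = Annotated L constant

    edge⁺ : ∀ P {d e κ} → J.R⟦ P ⟧ d e → I.R⟦ P ⟧ d e κ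
    edge⁺ (role R) p = p
    edge⁺ (inv R)  p = p

    edge⁻ : ∀ P {d e κ} → I.R⟦ P ⟧ d e κ → J.R⟦ P ⟧ d e
    edge⁻ (role R) p = p
    edge⁻ (inv R)  p = p

    -- The edge carries `κ`, since `top` cannot have any annotation but `𝟙`; for this reason the
    -- transfer is stated for basic concepts only.
    basic⁺ : ∀ B {d κ} → J.C⟦ ⌜ B ⌝ ⟧ d → I.C⟦ ⌜ B ⌝ ⟧ d κ
    basic⁺ (nameᵇ A) p = p
    basic⁺ (someᵇ P) {κ = κ} (e , p , _) = e , κ , 𝟙 , edge⁺ P p , lift Eq.refl ,
      Eq.sym (∧-identityʳ boundedMeetSemilattice κ)

    conc⁻ : ∀ C {d κ} → I.C⟦ C ⟧ d κ → J.C⟦ C ⟧ d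
    conc⁻ (name A)   p = p
    conc⁻ (some P C) (e , _ , _ , p , q , _) = e , edge⁻ P p , conc⁻ C q
    conc⁻ (C ⊓ D)    (_ , _ , p , q , _) = conc⁻ C p , conc⁻ D q
    conc⁻ top        _ = Unit.tt

    axiom⁺ : ∀ β κ → J.SatAxiom β → I.SatAxiom β κ
    axiom⁺ (conceptAssertion A a) κ s = s
    axiom⁺ (roleAssertion R a b)  κ s = s
    axiom⁺ (gci C (basic B))      κ s d _ p = basic⁺ B (s d (conc⁻ C p))
    axiom⁺ (gci C bot)            κ s d _ p with () ← s d (conc⁻ C p)
    axiom⁺ (positiveRI P Q)       κ s d e _ p = edge⁺ Q (s d e (edge⁻ P p))
    axiom⁺ (negativeRI P Q)       κ s d e _ (_ , _ , p , q , _) =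
      s d e (edge⁻ P p , edge⁻ Q q)

    model⁺ : (O : AnnotatedOntology L S) →
             J.Model ⟨ AnnotatedOntology.ontology O ⟩ → I.Model O
    model⁺ O model j = axiom⁺ (axiom j) (ann j) (model _ (j , ≡.refl))
      where open AnnotatedOntology O

-- Soundness of derivations in annotated models

module _ {c ℓ₁ ℓ₂ : Level} (L : BoundedLattice c ℓ₁ ℓ₂) {S : Signature}
         (O : AnnotatedOntology L S) where
  open BoundedLattice L renaming (⊤ to 𝟙; ⊥ to 𝟘)
  open LatticeProperties L
  open AnnotatedOntology O

  private
    i : Level
    i = c ⊔ ℓ₁ ⊔ ℓ₂

    value : Carrier → Subset (1+ size) → Carrier
    value κ M = ⋀ L M (weight κ ann)

  value-∪ : ∀ {κ} j M → value κ (⁅ fsuc j ⁆ ∪ M) ≈ ann j ∧ value κ M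
  value-∪ {κ} j M = Eq.trans (⋀-∪ ⁅ fsuc j ⁆ M _)
    (∧-cong meetSemilattice (⋀-⁅⁆ (fsuc j) (weight κ ann)) Eq.refl)

  module AnnotatedSoundness (G : Seed S) (I : AnnInterpretation L S)
    (model : Annotated.Model L I O) {κ : Carrier}
    (realisation : AnnRealisation L G I κ) where

    open Chase i ontology G
    open AnnInterpretation I
    open Annotated L I hiding (Model)
    open AnnRealisation realisation

    private
      apply : ∀ {j β} → axiom j ≡ β → SatAxiom β (ann j)
      apply {j} ≡.refl = model j

    -- One recursion defines the homomorphism and proves it sound: a witness goes to the successor
    -- that the model must supply at the value of the stored derivation.
    ⟦_⟧ : Elem → Δ
    conc-sound : ∀ {C d M} → Conc C d M → C⟦ C ⟧ ⟦ d ⟧ (value κ M)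
    edge-sound : ∀ {P d e M} → Edge P d e M → R⟦ P ⟧ ⟦ d ⟧ ⟦ e ⟧ (value κ M)

    ⟦ ind a ⟧  = indᴵ a
    ⟦ seed x ⟧ = at x
    ⟦ witness {P = P} eq p ⟧ = proj₁ (some-top-edge L I P (apply eq _ _ (conc-sound p)))

    conc-sound (asserted {j} eq) =
      concᴵ-resp _ _ (Eq.sym (⋀-⁅⁆ (fsuc j) (weight κ ann))) (apply eq)
    conc-sound (seeded c) = concᴵ-resp _ _ (Eq.sym (⋀-⁅⁆ zero (weight κ ann))) (conc-✓ c)
    conc-sound (derived {j} {M = M} eq p) =
      concᴵ-resp _ _ (Eq.sym (value-∪ j M)) (apply eq _ _ (conc-sound p))
    conc-sound (both {M = M} {N} p q) = _ , _ , conc-sound p , conc-sound q , ⋀-∪ M N _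
    conc-sound (along {M = M} {N} p q) =
      _ , _ , _ , edge-sound p , conc-sound q , ⋀-∪ M N _
    conc-sound trivial = lift (⋀-∅ (weight κ ann))

    edge-sound (asserted {j} eq) =
      roleᴵ-resp _ _ _ (Eq.sym (⋀-⁅⁆ (fsuc j) (weight κ ann))) (apply eq)
    edge-sound (seeded c) = roleᴵ-resp _ _ _ (Eq.sym (⋀-⁅⁆ zero (weight κ ann))) (edge-✓ c)
    edge-sound (witnessed {j} {P = P} {M = M} eq p) = role-resp L I P _ _ (Eq.sym (value-∪ j M))
      (proj₂ (some-top-edge L I P (apply eq _ _ (conc-sound p))))
    edge-sound (included {j} {Q = Q} {M = M} eq p) =
      role-resp L I Q _ _ (Eq.sym (value-∪ j M)) (apply eq _ _ _ (edge-sound p))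
    edge-sound (converse p)  = edge-sound p
    edge-sound (converse⁻ p) = edge-sound p

    module _ {n} (π : Fin n → Elem) where
      term-≡ : (t : Term S n) → ⟦ [ ind , π ]′ t ⟧ ≡ [ indᴵ , ⟦_⟧ ∘ π ]′ t
      term-≡ (inj₁ a) = ≡.refl
      term-≡ (inj₂ x) = ≡.refl

      atom-sound : ∀ a {M} → AtomDer π a M → SatAtom (⟦_⟧ ∘ π) a (value κ M)
      atom-sound (conceptAtom A t) p =
        ≡.subst (λ d → concᴵ A d _) (term-≡ t) (conc-sound p)
      atom-sound (roleAtom R t u)  p =
        ≡.subst₂ (λ d e → roleᴵ R d e _) (term-≡ t) (term-≡ u) (edge-sound p)

  -- The canonical annotated and classical models

  module Canonical (G : Seed S) (I₀ : AnnInterpretation L S)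
    (model₀ : Annotated.Model L I₀ O) {κ₀ : Carrier}
    (realisation₀ : AnnRealisation L G I₀ κ₀) where

    open Chase i ontology G
    private module Sound = AnnotatedSoundness G I₀ model₀ realisation₀

    -- A derivation of `C` would be sent into `I₀`, where the axiom leaves `C` empty. No rule
    -- enforces the negative axioms; they hold in both canonical models because `I₀` realises the
    -- seed.
    no-bot : ∀ {j C d M} → axiom j ≡ gci C bot → ¬ Conc C d M
    no-bot {j} eq p
      with () ← ≡.subst (λ β → Annotated.SatAxiom L I₀ β (ann j)) eq (model₀ j) _ _
                  (Sound.conc-sound p)

    no-clash : ∀ {j P Q d e M N} → axiom j ≡ negativeRI P Q → Edge P d e M → ¬ Edge Q d e N
    no-clash {j} eq p q =
      ≡.subst (λ β → Annotated.SatAxiom L I₀ β (ann j)) eq (model₀ j) _ _ _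
        (_ , _ , Sound.edge-sound p , Sound.edge-sound q , Eq.refl)

    module Annotation where
      interpretation : AnnInterpretation L S
      interpretation = record
        { Δ = Elem ; nonempty = seed (Seed.point G) ; indᴵ = ind
        ; concᴵ = λ A d κ → ∃[ M ] (Conc (name A) d M × κ ≈ value 𝟙 M)
        ; roleᴵ = λ R d e κ → ∃[ M ] (Edge (role R) d e M × κ ≈ value 𝟙 M)
        ; concᴵ-resp = λ { A d eq (M , p , κ≈) → M , p , Eq.trans (Eq.sym eq) κ≈ }
        ; roleᴵ-resp = λ { R d e eq (M , p , κ≈) → M , p , Eq.trans (Eq.sym eq) κ≈ } }

      open Annotated L interpretation hiding (Model)

      edge⁻ : ∀ P {d e κ} → R⟦ P ⟧ d e κ → ∃[ M ] (Edge P d e M × κ ≈ value 𝟙 M)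
      edge⁻ (role R) p = p
      edge⁻ (inv R)  (M , p , κ≈) = M , converse p , κ≈

      edge⁺ : ∀ P {d e κ M} → Edge P d e M → κ ≈ value 𝟙 M → R⟦ P ⟧ d e κ
      edge⁺ (role R) p κ≈ = _ , p , κ≈
      edge⁺ (inv R)  p κ≈ = _ , converse⁻ p , κ≈

      -- The rules `both`, `along` and `trivial` mirror the annotated semantics of complex concepts,
      -- with unions of labels in place of products.
      conc⁻ : ∀ C {d κ} → C⟦ C ⟧ d κ → ∃[ M ] (Conc C d M × κ ≈ value 𝟙 M)
      conc⁻ (name A)   p = p
      conc⁻ (some P C) (e , _ , _ , p , q , κ≈) =
        let M , p′ , ≈M = edge⁻ P p
            N , q′ , ≈N = conc⁻ C q
        in M ∪ N , along p′ q′ , Eq.trans κ≈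
             (Eq.trans (∧-cong meetSemilattice ≈M ≈N) (Eq.sym (⋀-∪ M N _)))
      conc⁻ (C ⊓ D)    (_ , _ , p , q , κ≈) =
        let M , p′ , ≈M = conc⁻ C p
            N , q′ , ≈N = conc⁻ D q
        in M ∪ N , both p′ q′ , Eq.trans κ≈
             (Eq.trans (∧-cong meetSemilattice ≈M ≈N) (Eq.sym (⋀-∪ M N _)))
      conc⁻ top        (lift κ≈) = ∅ , trivial , Eq.trans κ≈ (Eq.sym (⋀-∅ (weight 𝟙 ann)))

      conc⁺ : ∀ {C d κ M} → Conc C d M → κ ≈ value 𝟙 M → C⟦ C ⟧ d κ
      conc⁺ {name A} p κ≈ = _ , p , κ≈
      conc⁺ {some P C} (along {M = M} {N} p q) κ≈ = _ , _ , _ ,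
        edge⁺ P p Eq.refl , conc⁺ q Eq.refl , Eq.trans κ≈ (⋀-∪ M N _)
      conc⁺ {C ⊓ D} (both {M = M} {N} p q) κ≈ = _ , _ ,
        conc⁺ p Eq.refl , conc⁺ q Eq.refl , Eq.trans κ≈ (⋀-∪ M N _)
      conc⁺ {top} trivial κ≈ = lift (Eq.trans κ≈ (⋀-∅ (weight 𝟙 ann)))

      private
        add : ∀ {κ} j M → κ ≈ value 𝟙 M → ann j ∧ κ ≈ value 𝟙 (⁅ fsuc j ⁆ ∪ M)
        add j M κ≈ = Eq.trans (∧-cong meetSemilattice Eq.refl κ≈) (Eq.sym (value-∪ j M))

      axiom-✓ : ∀ {j} β → axiom j ≡ β → SatAxiom β (ann j)
      axiom-✓ {j} (conceptAssertion A a) eq = _ , asserted eq , Eq.sym (⋀-⁅⁆ (fsuc j) (weight 𝟙 ann))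
      axiom-✓ {j} (roleAssertion R a b)  eq = _ , asserted eq , Eq.sym (⋀-⁅⁆ (fsuc j) (weight 𝟙 ann))
      axiom-✓ {j} (gci C (basic B)) eq d _ p =
        let M , p′ , κ≈ = conc⁻ C p in conc⁺ (fire B eq p′) (add j M κ≈)
      axiom-✓ (gci C bot) eq d _ p =
        let _ , p′ , _ = conc⁻ C p in ⊥-elim (no-bot eq p′)
      axiom-✓ {j} (positiveRI P Q) eq d e _ p =
        let M , p′ , κ≈ = edge⁻ P p in edge⁺ Q (included eq p′) (add j M κ≈)
      axiom-✓ (negativeRI P Q) eq d e _ (_ , _ , p , q , _) =
        let _ , p′ , _ = edge⁻ P p
            _ , q′ , _ = edge⁻ Q q
        in no-clash eq p′ q′

      model : Annotated.Model L interpretation O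
      model j = axiom-✓ _ ≡.refl

      atom⁻ : ∀ {n} (π : Fin n → Elem) a {κ} → SatAtom π a κ →
              ∃[ M ] (AtomDer π a M × κ ≈ value 𝟙 M)
      atom⁻ π (conceptAtom A t) p = p
      atom⁻ π (roleAtom R t u)  p = p

      -- The union of the atom labels has the product of their values as its value, and it provides
      -- a single set of axioms deriving the whole match.
      atoms⁻ : ∀ {n} (π : Fin n → Elem) {as κs} → Pointwise (SatAtom π) as κs →
               ∃[ N ] (All (AtomWithin π N) as
                       × foldr _∧_ 𝟙 κs ≈ value 𝟙 N)
      atoms⁻ π [] = ∅ , [] , Eq.sym (⋀-∅ (weight 𝟙 ann))
      atoms⁻ π (p ∷ ps) =
        let M , p′ , ≈M  = atom⁻ π _ p
            N , ps′ , ≈N = atoms⁻ π ps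
        in M ∪ N , (M , p′ , p⊆p∪q N) ∷
             All.map (widen π (q⊆p∪q M N)) ps′ ,
           Eq.trans (∧-cong meetSemilattice ≈M ≈N) (Eq.sym (⋀-∪ M N _))

    module Restriction (M₀ : Subset size) where
      private
        K : Label
        K = inside ∷ M₀

      interpretation : Interpretation S i
      interpretation = record
        { Δ = Elem ; nonempty = seed (Seed.point G) ; indᴵ = ind
        ; concᴵ = λ A d → ∃[ M ] (Conc (name A) d M × M ⊆ K)
        ; roleᴵ = λ R d e → ∃[ M ] (Edge (role R) d e M × M ⊆ K) }

      open Classical interpretation hiding (Model)

      edge⁻ : ∀ P {d e} → R⟦ P ⟧ d e → ∃[ M ] (Edge P d e M × M ⊆ K)
      edge⁻ (role R) p = p
      edge⁻ (inv R)  (M , p , s) = M , converse p , s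

      edge⁺ : ∀ P {d e M} → Edge P d e M → M ⊆ K → R⟦ P ⟧ d e
      edge⁺ (role R) p s = _ , p , s
      edge⁺ (inv R)  p s = _ , converse⁻ p , s

      conc⁻ : ∀ C {d} → C⟦ C ⟧ d → ∃[ M ] (Conc C d M × M ⊆ K)
      conc⁻ (name A)   p = p
      conc⁻ (some P C) (e , p , q) =
        let _ , p′ , s = edge⁻ P p
            _ , q′ , t = conc⁻ C q
        in _ , along p′ q′ , ∪-least s t
      conc⁻ (C ⊓ D)    (p , q) =
        let _ , p′ , s = conc⁻ C p
            _ , q′ , t = conc⁻ D q
        in _ , both p′ q′ , ∪-least s t
      conc⁻ top        _ = ∅ , trivial , ⊥-elim ∘ ∉⊥

      conc⁺ : ∀ {C d M} → Conc C d M → M ⊆ K → C⟦ C ⟧ d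
      conc⁺ {name A}   p s = _ , p , s
      conc⁺ {some P C} (along {M = M} {N} p q) s =
        _ , edge⁺ P p (s ∘ p⊆p∪q N) , conc⁺ q (s ∘ q⊆p∪q M N)
      conc⁺ {C ⊓ D}    (both {M = M} {N} p q) s =
        conc⁺ p (s ∘ p⊆p∪q N) , conc⁺ q (s ∘ q⊆p∪q M N)
      conc⁺ {top}      _ _ = Unit.tt

      private
        add : ∀ {j M} → j ∈ M₀ → M ⊆ K → ⁅ fsuc j ⁆ ∪ M ⊆ K
        add j∈ = ∪-least (⁅⁆-least (there j∈))

      model : Classical.Model interpretation (ontology ↾ M₀)
      model (conceptAssertion A a) (j , j∈ , eq) = _ , asserted eq , ⁅⁆-least (there j∈)
      model (roleAssertion R a b)  (j , j∈ , eq) = _ , asserted eq , ⁅⁆-least (there j∈)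
      model (gci C (basic B)) (j , j∈ , eq) d p =
        let _ , p′ , s = conc⁻ C p in conc⁺ (fire B eq p′) (add j∈ s)
      model (gci C bot) (j , j∈ , eq) d p =
        let _ , p′ , _ = conc⁻ C p in ⊥-elim (no-bot eq p′)
      model (positiveRI P Q) (j , j∈ , eq) d e p =
        let _ , p′ , s = edge⁻ P p in edge⁺ Q (included eq p′) (add j∈ s)
      model (negativeRI P Q) (j , j∈ , eq) d e (p , q) =
        let _ , p′ , _ = edge⁻ P p
            _ , q′ , _ = edge⁻ Q q
        in no-clash eq p′ q′

      atom⁻ : ∀ {n} (π : Fin n → Elem) a → SatAtom π a → AtomWithin π K a
      atom⁻ π (conceptAtom A t) p = p
      atom⁻ π (roleAtom R t u)  p = p

      -- The labels are kept apart here, since an annotated match assigns an annotation to each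
      -- atom.
      atoms⁻ : ∀ {n} (π : Fin n → Elem) {as} → All (SatAtom π) as →
               ∃[ Ms ] (Pointwise (AtomDer π) as Ms × All (_⊆ K) Ms)
      atoms⁻ π [] = [] , [] , []
      atoms⁻ π (p ∷ ps) =
        let _ , p′ , s = atom⁻ π _ p
            _ , ps′ , ss = atoms⁻ π ps
        in _ , p′ ∷ ps′ , s ∷ ss

-- Seeds for left-hand sides and their realisations

module _ {S : Signature} where

  -- An anonymous point without facts, so that the domain is nonempty even when there are no
  -- individuals.
  emptySeed : Seed S
  emptySeed = record
    { Point = ⊤ ; point = tt ; conc = λ _ _ → ⊥ ; edge = λ _ _ _ → ⊥ }

  -- Seeds hold facts about role names only; reversing the edge for an inverse role makes `P` lead
  -- from `false` to `true` in both cases.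
  data NamedEdge : Role S → Signature.NR S → Bool → Bool → Set where
    forward  : ∀ {R} → NamedEdge (role R) R false true
    backward : ∀ {R} → NamedEdge (inv R) R true false

  edgeSeed : Role S → Seed S
  edgeSeed P = record
    { Point = Bool ; point = false ; conc = λ _ _ → ⊥ ; edge = NamedEdge P }

  basicSeed : Basic S → Seed S
  basicSeed (nameᵇ A) = record
    { Point = ⊤ ; point = tt ; conc = λ A′ _ → A ≡ A′ ; edge = λ _ _ _ → ⊥ }
  basicSeed (someᵇ P) = edgeSeed P

  module _ {i : Level} (O : Ontology S) where
    open Chase i O

    edgeSeed-edge : ∀ P → Edge (edgeSeed P) P (seed false) (seed true) ⁅ zero ⁆
    edgeSeed-edge (role R) = seeded forward
    edgeSeed-edge (inv R)  = converse (seeded backward)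

    basicSeed-conc : ∀ B → Conc (basicSeed B) ⌜ B ⌝ (seed (Seed.point (basicSeed B))) ⁅ zero ⁆
    basicSeed-conc (nameᵇ A) = seeded ≡.refl
    basicSeed-conc (someᵇ P) = along-top (edgeSeed P) (edgeSeed-edge P)

  module _ {i : Level} (J : Interpretation S i) where
    open Classical J

    -- Matching on the returned equations moves soundness from the images of the seed points to the
    -- given `d` and `e`.
    realise-edge : ∀ P {d e} → R⟦ P ⟧ d e →
      Σ[ r ∈ Realisation (edgeSeed P) J ]
        (Realisation.at r false ≡ d × Realisation.at r true ≡ e)
    realise-edge P {d} {e} p = record
      { at = λ { false → d ; true → e } ; conc-✓ = λ ()
      ; edge-✓ = λ { forward → p ; backward → p } } , ≡.refl , ≡.refl

    realise-basic : ∀ B {d} → C⟦ ⌜ B ⌝ ⟧ d →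
      Σ[ r ∈ Realisation (basicSeed B) J ]
        Realisation.at r (Seed.point (basicSeed B)) ≡ d
    realise-basic (nameᵇ A) {d} p = record
      { at = λ _ → d ; conc-✓ = λ { ≡.refl → p } ; edge-✓ = λ () } , ≡.refl
    realise-basic (someᵇ P) (e , p , _) =
      let r , eq , _ = realise-edge P p in r , eq

  module _ {c ℓ₁ ℓ₂ : Level} (L : BoundedLattice c ℓ₁ ℓ₂) (I : AnnInterpretation L S) where
    open Annotated L I

    annRealise-edge : ∀ P {d e κ} → R⟦ P ⟧ d e κ →
      Σ[ r ∈ AnnRealisation L (edgeSeed P) I κ ]
        (AnnRealisation.at r false ≡ d × AnnRealisation.at r true ≡ e)
    annRealise-edge P {d} {e} p = record
      { at = λ { false → d ; true → e } ; conc-✓ = λ ()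
      ; edge-✓ = λ { forward → p ; backward → p } } , ≡.refl , ≡.refl

    annRealise-basic : ∀ B {d κ} → C⟦ ⌜ B ⌝ ⟧ d κ →
      Σ[ r ∈ AnnRealisation L (basicSeed B) I κ ]
        AnnRealisation.at r (Seed.point (basicSeed B)) ≡ d
    annRealise-basic (nameᵇ A) {d} p = record
      { at = λ _ → d ; conc-✓ = λ { ≡.refl → p } ; edge-✓ = λ () } , ≡.refl
    annRealise-basic (someᵇ P) p =
      let r , eq , _ = annRealise-edge P (proj₂ (some-top-edge L I P p)) in r , eq

-- Comparing entailed annotations with infima over subsets

module _ {c ℓ₁ ℓ₂ : Level} (L : BoundedLattice c ℓ₁ ℓ₂) {S : Signature}
         (O : AnnotatedOntology L S) where
  open BoundedLattice L renaming (⊤ to 𝟙; ⊥ to 𝟘)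
  open LatticeProperties L
  open AnnotatedOntology O

  private
    i : Level
    i = c ⊔ ℓ₁ ⊔ ℓ₂

  MutuallyCofinal : Formula S → Set (suc i)
  MutuallyCofinal α =
    (∀ {κ} → AnnEntails L O α κ → ∃[ x ] (SubsetInfimum L O α x × κ ≤ x)) ×
    (∀ {κ} → SubsetInfimum L O α κ → ∃[ x ] (AnnEntails L O α x × κ ≤ x))

  mutuallyCofinal : ∀ α →
    (∀ {κ} → AnnEntails L O α κ →
      ∃[ M ] (Entails i (ontology ↾ M) α × κ ≈ ⋀ L M ann)) →
    (∀ M₀ → Entails i (ontology ↾ M₀) α →
      ∃[ κ ] (AnnEntails L O α κ × ⋀ L M₀ ann ≤ κ)) →
    MutuallyCofinal α
  mutuallyCofinal _ to from =
    (λ h → _ , to h , refl) ,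
    (λ { (M₀ , h , κ≈) → let κ , h′ , ≤κ = from M₀ h
                         in κ , h′ , trans (reflexive κ≈) ≤κ })

  -- Equivalence in each single interpretation preserves both sets. Assertions are treated through
  -- it as queries with one atom.
  mutuallyCofinal-cong : ∀ α β →
    (∀ (I : AnnInterpretation L S) {κ} → Annotated.Sat L I α κ → Annotated.Sat L I β κ) →
    (∀ (I : AnnInterpretation L S) {κ} → Annotated.Sat L I β κ → Annotated.Sat L I α κ) →
    (∀ (J : Interpretation S i) → Classical.Sat J α → Classical.Sat J β) →
    (∀ (J : Interpretation S i) → Classical.Sat J β → Classical.Sat J α) →
    MutuallyCofinal α → MutuallyCofinal β
  mutuallyCofinal-cong _ _ αβ βα αβᶜ βαᶜ (to , from) =
    (λ h → let _ , (M , h′ , x≈) , ≤x = to (λ I m → βα I (h I m))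
           in _ , (M , (λ J m → αβᶜ J (h′ J m)) , x≈) , ≤x) ,
    (λ { (M , h , κ≈) → let _ , h′ , ≤x = from (M , (λ J m → βαᶜ J (h J m)) , κ≈)
                        in _ , (λ I m → αβ I (h′ I m)) , ≤x })

  query-cofinal : AnnSatisfiable L O → ∀ q → MutuallyCofinal (queryᶠ q)
  query-cofinal (I₀ , model₀) q = mutuallyCofinal (queryᶠ q) to from
    where
    open BCQ q

    annRealise : ∀ I → AnnRealisation L emptySeed I 𝟙
    annRealise I = record
      { at = λ _ → AnnInterpretation.nonempty I ; conc-✓ = λ () ; edge-✓ = λ () }

    open Chase i ontology emptySeed
    open Canonical L O emptySeed I₀ model₀ (annRealise I₀)

    to : ∀ {κ} → AnnEntails L O (queryᶠ q) κ →
         ∃[ M ] (Entails i (ontology ↾ M) (queryᶠ q) × κ ≈ ⋀ L M ann)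
    to h with h Annotation.interpretation Annotation.model
    ... | π , _ , ps , κ≈ with Annotation.atoms⁻ π ps
    ... | b ∷ M , ds , ≈N = M ,
      (λ J m → let open ClassicalSoundness ontology emptySeed M J m (record
                     { at = λ _ → Interpretation.nonempty J
                     ; conc-✓ = λ () ; edge-✓ = λ () })
               in ⟦_⟧ ∘ π , All.map (λ { {a} (_ , p , s) →
                    atom-sound π a p (λ x∈ → ∷⊆inside∷ (s x∈)) }) ds) ,
      Eq.trans κ≈ (Eq.trans ≈N (⋀-weight-𝟙 b M ann))

    from : ∀ M₀ → Entails i (ontology ↾ M₀) (queryᶠ q) →
           ∃[ κ ] (AnnEntails L O (queryᶠ q) κ × ⋀ L M₀ ann ≤ κ)
    from M₀ h =
      let π , ps = h (Restriction.interpretation M₀) (Restriction.model M₀)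
          Ms , ds , ss = Restriction.atoms⁻ M₀ π ps
      -- The annotation is the product of the values of the atom labels. Each label lies below `M₀`
      -- with the seed axiom added, which bounds the product from below.
      in foldr _∧_ 𝟙 (map value Ms) ,
         (λ I m → let open AnnotatedSoundness L O emptySeed I m (annRealise I)
                  in ⟦_⟧ ∘ π , _ , sound I m π ds , Eq.refl) ,
         bound ss
      where
      value : Label → Carrier
      value M = ⋀ L M (weight 𝟙 ann)

      sound : ∀ I m (π : Fin #vars → Elem) {as Ms} → Pointwise (AtomDer π) as Ms →
        let open AnnotatedSoundness L O emptySeed I m (annRealise I) in
        Pointwise (Annotated.SatAtom L I (⟦_⟧ ∘ π)) as (map value Ms)
      sound I m π []       = []
      sound I m π (d ∷ ds) =
        AnnotatedSoundness.atom-sound L O emptySeed I m (annRealise I) π _ d ∷ sound I m π ds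

      bound : ∀ {Ms} → All (_⊆ inside ∷ M₀) Ms →
              ⋀ L M₀ ann ≤ foldr _∧_ 𝟙 (map value Ms)
      bound []       = maximum _
      bound (_∷_ {M} s ss) = ∧-greatest
        (trans (reflexive (Eq.sym (⋀-weight-𝟙 inside M₀ ann)))
               (⋀-antitone {M = M} (weight 𝟙 ann) s))
        (bound ss)

  conceptAssertion-cofinal : AnnSatisfiable L O → ∀ A a →
                             MutuallyCofinal (axiomᶠ (conceptAssertion A a))
  conceptAssertion-cofinal sat A a = mutuallyCofinal-cong
    (queryᶠ q) (axiomᶠ (conceptAssertion A a))
    (λ { I (_ , _ , p ∷ [] , κ≈) → AnnInterpretation.concᴵ-resp I A _
           (Eq.sym (Eq.trans κ≈ (∧-identityʳ boundedMeetSemilattice _))) p })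
    (λ I p → (λ ()) , _ , p ∷ [] , Eq.sym (∧-identityʳ boundedMeetSemilattice _))
    (λ { J (_ , p ∷ []) → p })
    (λ J p → (λ ()) , p ∷ [])
    (query-cofinal sat q)
    where
    q : BCQ S
    q = record { #vars = 0 ; atoms = conceptAtom A (inj₁ a) ∷ [] }

  roleAssertion-cofinal : AnnSatisfiable L O → ∀ R a b →
                          MutuallyCofinal (axiomᶠ (roleAssertion R a b))
  roleAssertion-cofinal sat R a b = mutuallyCofinal-cong
    (queryᶠ q) (axiomᶠ (roleAssertion R a b))
    (λ { I (_ , _ , p ∷ [] , κ≈) → AnnInterpretation.roleᴵ-resp I R _ _
           (Eq.sym (Eq.trans κ≈ (∧-identityʳ boundedMeetSemilattice _))) p })
    (λ I p → (λ ()) , _ , p ∷ [] , Eq.sym (∧-identityʳ boundedMeetSemilattice _))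
    (λ { J (_ , p ∷ []) → p })
    (λ J p → (λ ()) , p ∷ [])
    (query-cofinal sat q)
    where
    q : BCQ S
    q = record { #vars = 0 ; atoms = roleAtom R (inj₁ a) (inj₁ b) ∷ [] }

  positiveRI-cofinal : ∀ P Q → RoleSatisfiable i ontology P →
                       MutuallyCofinal (axiomᶠ (positiveRI P Q))
  positiveRI-cofinal P Q (J₀ , model₀ , _ , _ , p₀) =
    mutuallyCofinal (axiomᶠ (positiveRI P Q)) to from
    where
    open Constant L J₀
    open Chase i ontology (edgeSeed P)
    -- A classical model in which `P` is nonempty realises the seed, which rules out derivable
    -- violations of negative axioms.
    open Canonical L O (edgeSeed P) constant (model⁺ O model₀)
      (proj₁ (annRealise-edge L constant P (edge⁺ P {κ = 𝟙} p₀)))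

    to : ∀ {κ} → AnnEntails L O (axiomᶠ (positiveRI P Q)) κ →
         ∃[ M ] (Entails i (ontology ↾ M) (axiomᶠ (positiveRI P Q)) × κ ≈ ⋀ L M ann)
    -- The seed edge has annotation `𝟙`, so the inclusion yields a `Q`-edge with annotation `κ ∧ 𝟙`.
    -- The label of its derivation gives the subset sought.
    to h with Annotation.edge⁻ Q (h Annotation.interpretation Annotation.model _ _ 𝟙
                (Annotation.edge⁺ P (edgeSeed-edge ontology P)
                  (Eq.sym (⋀-⁅⁆ zero (weight 𝟙 ann)))))
    ... | b ∷ M , p , κ∧𝟙≈ = M , entails ,
      Eq.trans (Eq.sym (∧-identityʳ boundedMeetSemilattice _))
               (Eq.trans κ∧𝟙≈ (⋀-weight-𝟙 b M ann))
      where
      entails : Entails i (ontology ↾ M) (axiomᶠ (positiveRI P Q))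
      entails J m d e pᴶ with realise-edge J P pᴶ
      ... | r , ≡.refl , ≡.refl =
        ClassicalSoundness.edge-sound ontology (edgeSeed P) M J m r p ∷⊆inside∷

    from : ∀ M₀ → Entails i (ontology ↾ M₀) (axiomᶠ (positiveRI P Q)) →
           ∃[ κ ] (AnnEntails L O (axiomᶠ (positiveRI P Q)) κ × ⋀ L M₀ ann ≤ κ)
    from M₀ h with Restriction.edge⁻ M₀ Q
        (h (Restriction.interpretation M₀) (Restriction.model M₀) _ _
          (Restriction.edge⁺ M₀ P (edgeSeed-edge ontology P) (⁅⁆-least here)))
    -- Since the label contains the seed axiom, its value in a model is `κ ∧ ⋀ L M ann` with `κ` the
    -- annotation of the `P`-edge, exactly what the annotated inclusion demands.
    ... | b ∷ M , p , s with here ← seed-edge-uses-seed p =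
      ⋀ L M ann , entails , ⋀-antitone {M = M} ann (drop-∷-⊆ s)
      where
      entails : AnnEntails L O (axiomᶠ (positiveRI P Q)) (⋀ L M ann)
      entails I m d e κ pᴵ with annRealise-edge L I P pᴵ
      ... | r , ≡.refl , ≡.refl = role-resp L I Q _ _ (∧-comm meetSemilattice κ _)
        (AnnotatedSoundness.edge-sound L O (edgeSeed P) I m r p)

  -- The model `J₀` refutes the axiom classically and, through `constant`, also in annotated form,
  -- so both sets are empty.
  negativeRI-cofinal : ∀ P Q → RoleConjunctionSatisfiable i ontology P Q →
                       MutuallyCofinal (axiomᶠ (negativeRI P Q))
  negativeRI-cofinal P Q (J₀ , model₀ , d , e , p , q) =
    (λ h → ⊥-elim (h constant (model⁺ O model₀) d e (𝟙 ∧ 𝟙)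
       (𝟙 , 𝟙 , edge⁺ P p , edge⁺ Q q , Eq.refl))) ,
    (λ { (M , h , _) →
       ⊥-elim (h J₀ (λ { β (j , _ , eq) → model₀ β (j , eq) }) d e (p , q)) })
    where open Constant L J₀

  basicGCI-cofinal : ∀ B B′ → ConceptSatisfiable i ontology ⌜ B ⌝ → NoTopLhs ontology →
                     MutuallyCofinal (axiomᶠ (gci ⌜ B ⌝ (basic B′)))
  basicGCI-cofinal B B′ (J₀ , model₀ , _ , p₀) noTop =
    mutuallyCofinal α to from
    where
    α : Formula S
    α = axiomᶠ (gci ⌜ B ⌝ (basic B′))

    open Constant L J₀ using (constant; model⁺; basic⁺)
    open Chase i ontology (basicSeed B)
    open Canonical L O (basicSeed B) constant (model⁺ O model₀)
      (proj₁ (annRealise-basic L constant B (basic⁺ B {κ = 𝟙} p₀)))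

    -- A basic concept is never `IsTop`, which closes the escape left open by `conc-uses-seed`.
    uses-seed : ∀ B {x M} → Conc ⌜ B ⌝ (seed x) M → zero ∈ M
    uses-seed B p with conc-uses-seed noTop ≡.refl p
    uses-seed _ p         | inj₁ z = z
    uses-seed (nameᵇ _) p | inj₂ ()
    uses-seed (someᵇ _) p | inj₂ ()

    to : ∀ {κ} → AnnEntails L O α κ →
         ∃[ M ] (Entails i (ontology ↾ M) α × κ ≈ ⋀ L M ann)
    to h with Annotation.conc⁻ ⌜ B′ ⌝ (h Annotation.interpretation Annotation.model _ 𝟙
                (Annotation.conc⁺ (basicSeed-conc ontology B)
                  (Eq.sym (⋀-⁅⁆ zero (weight 𝟙 ann)))))
    ... | b ∷ M , p , κ∧𝟙≈ = M , entails ,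
      Eq.trans (Eq.sym (∧-identityʳ boundedMeetSemilattice _))
               (Eq.trans κ∧𝟙≈ (⋀-weight-𝟙 b M ann))
      where
      entails : Entails i (ontology ↾ M) α
      entails J m d pᴶ with realise-basic J B pᴶ
      ... | r , ≡.refl =
        ClassicalSoundness.conc-sound ontology (basicSeed B) M J m r p ∷⊆inside∷

    from : ∀ M₀ → Entails i (ontology ↾ M₀) α →
           ∃[ κ ] (AnnEntails L O α κ × ⋀ L M₀ ann ≤ κ)
    from M₀ h with Restriction.conc⁻ M₀ ⌜ B′ ⌝
        (h (Restriction.interpretation M₀) (Restriction.model M₀) _
          (Restriction.conc⁺ M₀ (basicSeed-conc ontology B) (⁅⁆-least here)))
    -- Here the exclusion of top left-hand sides enters: without the seed axiom in the label,
    -- soundness would give `⋀ L M ann` and not its meet with `κ`.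
    ... | b ∷ M , p , s with here ← uses-seed B′ p =
      ⋀ L M ann , entails , ⋀-antitone {M = M} ann (drop-∷-⊆ s)
      where
      entails : AnnEntails L O α (⋀ L M ann)
      entails I m d κ pᴵ with annRealise-basic L I B pᴵ
      ... | r , ≡.refl = conc-resp L I ⌜ B′ ⌝ _ (∧-comm meetSemilattice κ _)
        (AnnotatedSoundness.conc-sound L O (basicSeed B) I m r p)

  cofinal : AnnSatisfiable L O → ∀ α → Case₁ i ontology α ⊎ Case₂ i ontology α →
            MutuallyCofinal α
  cofinal sat _ (inj₁ (query q))                 = query-cofinal sat q
  cofinal sat _ (inj₁ (conceptAssertion A a))    = conceptAssertion-cofinal sat A a
  cofinal sat _ (inj₁ (roleAssertion R a b))     = roleAssertion-cofinal sat R a b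
  cofinal sat _ (inj₁ (positiveRI P Q satP))     = positiveRI-cofinal P Q satP
  cofinal sat _ (inj₁ (negativeRI P Q satPQ))    = negativeRI-cofinal P Q satPQ
  cofinal sat _ (inj₂ (basicGCI B B′ satB noTop)) = basicGCI-cofinal B B′ satB noTop

proposition3p18 : ∀ {c ℓ₁ ℓ₂} (L : BoundedLattice c ℓ₁ ℓ₂) →
    let open BoundedLattice L in
    IsDistributiveLattice _≈_ _≤_ _∨_ _∧_ →
    (S : Signature) (O : AnnotatedOntology L S) → AnnSatisfiable L O →
    let open AnnotatedOntology O in
    (α : Formula S) →
    Case₁ (c ⊔ ℓ₁ ⊔ ℓ₂) ontology α ⊎ Case₂ (c ⊔ ℓ₁ ⊔ ℓ₂) ontology α →
    (∀ s → IsProvenance L O α s ⇔ IsSupremum L (SubsetInfimum L O α) s)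
    × (ExcludedMiddle (suc (c ⊔ ℓ₁ ⊔ ℓ₂)) →
    ∃[ s ] (IsProvenance L O α s × IsSupremum L (SubsetInfimum L O α) s))
proposition3p18 L _ S O sat α case =
  (λ s → mk⇔ (IsSupremum-cofinal to from) (IsSupremum-cofinal from to)) ,
  -- There are finitely many subsets, so their infima have a supremum once it is decided which
  -- subsets entail `α`. Cofinality carries it over to the entailed annotations, which are not given
  -- as a finite family.
  λ em → let s , sup = finite-supremum em (λ M → Entails _ (ontology ↾ M) α) (λ M → ⋀ L M ann)
         in s , IsSupremum-cofinal from to sup , sup
  where
  open LatticeProperties L
  open AnnotatedOntology O
  to   = proj₁ (cofinal L O sat α case)
  from = proj₂ (cofinal L O sat α case)
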